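{- Let $0<\varepsilon\le1/1000$, let $C^*$ be a vertex cover of minimum size in a graph $G=(V,E)$, and let $C$ be the set of all vertices that are frozen (i.e. become tight) in the vanilla algorithm described in the context. Then $C$ is a valid vertex cover of $G$, and $|C|\le(2+4\varepsilon)|C^*|$.
   Context: Vanilla algorithm on $G=(V,E)$ with maximum degree $\Delta$: each edge $e$ starts with value $x_e=\frac1\Delta$ and all edges are initially active. In each round, any node $v$ with $c_v=\sum_{e\ni v}x_e\ge1-\varepsilon$ is called tight (frozen), and all edges incident to tight nodes are frozen (their values no longer change). Then the value $x_e$ of every edge that is still active (not frozen) is updated to $(1+\varepsilon)x_e$, and the next round begins. The algorithm ends when no edge is active. -}

module Defs where

open import Level using (Level; suc; _⊔_)
open import Algebra.Bundles using (CommutativeRing)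
import Algebra.Properties.CommutativeMonoid.Sum as Sum
import Algebra.Properties.Monoid.Mult as Mult
open import Data.Bool.Base using (Bool; if_then_else_; _∧_; _∨_; not)
open import Data.Fin.Base as Fin using (Fin)
open import Data.Fin.Properties using (_≟_)
open import Data.Fin.Subset using (Subset; _∈_; _∪_; ∣_∣; ⊤; ⊥; Empty; Nonempty)
open import Data.List.Base using (map; allFin)
open import Data.List.Extrema.Nat using (max)
open import Data.Nat.Base as ℕ using (ℕ)
open import Data.Product.Base using (_×_; _,_; ∃)
open import Data.Sum.Base using (_⊎_)
open import Data.Vec.Base using (lookup; tabulate)
open import Relation.Binary.Core using (Rel)
open import Relation.Binary.Structures using (IsDecTotalOrder)
open import Relation.Binary.PropositionalEquality.Core using (_≡_)
open import Relation.Nullary.Decidable.Core using (does)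
open import Relation.Nullary.Negation.Core using (¬_)

-- Stand-in for the real numbers. Up to isomorphism the Archimedean ordered
-- fields are exactly the subfields of ℝ; classically ℝ itself is one.
-- The inverse is total, with an unspecified value at 0#.
record ArchimedeanOrderedField c ℓ₁ ℓ₂ : Set (suc (c ⊔ ℓ₁ ⊔ ℓ₂)) where
  infix 4 _≤_ _<_
  infix 8 _⁻¹
  field
    commutativeRing : CommutativeRing c ℓ₁
  open CommutativeRing commutativeRing public
  field
    _⁻¹             : Carrier → Carrier
    _≤_             : Rel Carrier ℓ₂
    isDecTotalOrder : IsDecTotalOrder _≈_ _≤_
    0#≉1#           : ¬ (0# ≈ 1#)
    *-inverseʳ      : ∀ x → ¬ (x ≈ 0#) → x * x ⁻¹ ≈ 1#
    +-monoʳ-≤       : ∀ x {y z} → y ≤ z → x + y ≤ x + z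
    *-nonNeg        : ∀ {x y} → 0# ≤ x → 0# ≤ y → 0# ≤ x * y

  open IsDecTotalOrder isDecTotalOrder public using (_≤?_)
  open Sum +-commutativeMonoid public using (sum)
  open Mult +-monoid public using () renaming (_×_ to _·_)

  _<_ : Rel Carrier (ℓ₁ ⊔ ℓ₂)
  x < y = x ≤ y × ¬ (x ≈ y)

  fromℕ : ℕ → Carrier
  fromℕ n = n · 1#

  field
    archimedean : ∀ x → ∃ λ n → x ≤ fromℕ n

-- Finite simple graph with V = Fin n and E = Fin m. Listing the endpoints of
-- each edge in increasing order excludes loops and makes `distinct` say that
-- no two edges join the same pair of vertices.
record Graph : Set where
  field
    n m      : ℕ
    src tgt  : Fin m → Fin n
    src<tgt  : ∀ e → src e Fin.< tgt e
    distinct : ∀ {e f} → src e ≡ src f → tgt e ≡ tgt f → e ≡ f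

  incident : Fin n → Fin m → Bool
  incident v e = does (v ≟ src e) ∨ does (v ≟ tgt e)

  degree : Fin n → ℕ
  degree v = ∣ tabulate (incident v) ∣

  Δ : ℕ
  Δ = max 0 (map degree (allFin n))

  IsVertexCover : Subset n → Set
  IsVertexCover S = ∀ e → src e ∈ S ⊎ tgt e ∈ S

  IsMinimumVertexCover : Subset n → Set
  IsMinimumVertexCover S =
    IsVertexCover S × (∀ T → IsVertexCover T → ∣ S ∣ ℕ.≤ ∣ T ∣)

module Vanilla {c ℓ₁ ℓ₂} (F : ArchimedeanOrderedField c ℓ₁ ℓ₂)
               (G : Graph) (ε : ArchimedeanOrderedField.Carrier F) where

  open ArchimedeanOrderedField F
  open Graph G

  record State : Set c where
    constructor state
    field
      value  : Fin m → Carrier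
      active : Subset m
      frozen : Subset n

  open State public

  -- When Δ is 0 there are no edges, so the junk value of 0 ⁻¹ is never used.
  initial : State
  initial = state (λ _ → fromℕ Δ ⁻¹) ⊤ ⊥

  load : (Fin m → Carrier) → Fin n → Carrier
  load x v = sum (λ e → if incident v e then x e else 0#)

  tight : (Fin m → Carrier) → Subset n
  tight x = tabulate (λ v → does ((1# - ε) ≤? load x v))

  round : State → State
  round (state x A K) = state x′ A′ K′
    where
    K′ : Subset n
    K′ = K ∪ tight x

    A′ : Subset m
    A′ = tabulate (λ e →
      lookup A e ∧ not (lookup K′ (src e)) ∧ not (lookup K′ (tgt e)))

    x′ : Fin m → Carrier
    x′ e = if lookup A′ e then (1# + ε) * x e else x e

  -- s ⇓ t: started in s, the loop ends, and it ends in t.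
  infix 4 _⇓_
  data _⇓_ : State → State → Set c where
    halt : ∀ {s} → Empty (active s) → s ⇓ s
    next : ∀ {s t} → Nonempty (active s) → round s ⇓ t → s ⇓ t

  FrozenSet : Subset n → Set c
  FrozenSet C = ∃ λ t → (initial ⇓ t) × frozen t ≡ C

{-# OPTIONS --safe #-}

-- The edge values form a fractional matching throughout: an unfrozen vertex has
-- load below 1 − ε, so one more round leaves it below (1 + ε)(1 − ε) ≤ 1, and a
-- frozen vertex keeps its load for ever.  Summing loads over any vertex cover
-- C* therefore gives Σ x ≤ |C*|, and summing over the frozen set C, where loads
-- are at least 1 − ε, gives (1 − ε)|C| ≤ 2 Σ x because an edge has two ends.
-- Finally (1 − ε)(1 + 2ε) ≥ 1.  The loop ends because by Bernoulli's inequality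
-- an edge still active after k rounds has value at least (1 + kε)/Δ.
module Submission where

open import Defs
open import Data.Bool.Base using (Bool; true; false; if_then_else_; _∨_; _∧_; not)
open import Data.Bool.Properties using (¬-not)
open import Data.Fin.Base as Fin using (Fin)
open import Data.Fin.Properties using (_≟_)
open import Data.Fin.Subset using (Subset; ∣_∣; _∈_; _∉_; Empty)
open import Data.Fin.Subset.Properties using (_∈?_; nonempty?; ∈⊤; ∉⊥; x∈p∪q⁻; x∈p∪q⁺)
open import Data.List.Extrema.Nat using (xs≤max)
open import Data.List.Membership.Propositional.Properties using (∈-map⁺; ∈-allFin)
import Data.List.Relation.Unary.All as All
open import Data.Nat.Base as ℕ using (ℕ; zero; suc; z≤n; s≤s)
import Data.Nat.Properties as ℕ
open import Data.Product.Base using (_×_; ∃; _,_; proj₁)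
open import Data.Sum.Base as Sum using (_⊎_; inj₁; inj₂; [_,_]′)
open import Data.Vec.Base using ([]; _∷_; lookup; tabulate; here; there)
open import Data.Vec.Properties using (lookup∘tabulate; []=⇒lookup; lookup⇒[]=)
open import Function.Base using (_∘_)
open import Relation.Binary.Bundles using (Poset)
open import Relation.Binary.PropositionalEquality as ≡ using (_≡_)
open import Relation.Binary.Structures using (IsDecTotalOrder)
open import Relation.Nullary using (¬_; Dec; yes; no; does; contradiction)
open import Relation.Nullary.Decidable using (dec-true)
import Level
import Algebra.Properties.AbelianGroup as AbelianGroupProperties
import Algebra.Properties.Ring as RingProperties
import Algebra.Properties.Semiring.Sum as SemiringSum
import Relation.Binary.Reasoning.PartialOrder as PosetReasoning

-- Decisions and subsets of finite sets.

does-true : ∀ {a} {A : Set a} (A? : Dec A) → does A? ≡ true → A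
does-true (yes a) _ = a

∈-tabulate⁻ : ∀ {n i} (f : Fin n → Bool) → i ∈ tabulate f → f i ≡ true
∈-tabulate⁻ {i = i} f i∈ = ≡.trans (≡.sym (lookup∘tabulate f i)) ([]=⇒lookup i∈)

∈-tabulate⁺ : ∀ {n i} (f : Fin n → Bool) → f i ≡ true → i ∈ tabulate f
∈-tabulate⁺ {i = i} f fi = lookup⇒[]= i _ (≡.trans (lookup∘tabulate f i) fi)

∉⇒lookup≡false : ∀ {n i} {p : Subset n} → i ∉ p → lookup p i ≡ false
∉⇒lookup≡false {i = i} {p} i∉p = ¬-not (i∉p ∘ lookup⇒[]= i p)

x∈p⇒0<∣p∣ : ∀ {n x} {p : Subset n} → x ∈ p → 0 ℕ.< ∣ p ∣
x∈p⇒0<∣p∣ here                    = s≤s z≤n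
x∈p⇒0<∣p∣ (there {y = true}  x∈p) = s≤s z≤n
x∈p⇒0<∣p∣ (there {y = false} x∈p) = x∈p⇒0<∣p∣ x∈p

-- Incidence and degrees.

module GraphProperties (G : Graph) where
  open Graph G

  incident-ends : ∀ v e → incident v e ≡ true → v ≡ src e ⊎ v ≡ tgt e
  incident-ends v e inc with v ≟ src e
  ... | yes v≡src = inj₁ v≡src
  ... | no  _     = inj₂ (does-true (v ≟ tgt e) inc)

  incident-src : ∀ e → incident (src e) e ≡ true
  incident-src e rewrite dec-true (src e ≟ src e) ≡.refl = ≡.refl

  incident-tgt : ∀ e → incident (tgt e) e ≡ true
  incident-tgt e with does (tgt e ≟ src e)
  ... | true  = ≡.refl
  ... | false = dec-true (tgt e ≟ tgt e) ≡.refl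

  degree≤Δ : ∀ v → degree v ℕ.≤ Δ
  degree≤Δ v = All.lookup (xs≤max 0 _) (∈-map⁺ degree (∈-allFin v))

  -- The source of the edge has degree at least one. As soon as some edge is given, `fromℕ Δ ⁻¹` is
  -- therefore a genuine inverse.
  edge⇒0<Δ : Fin m → 0 ℕ.< Δ
  edge⇒0<Δ e = ℕ.≤-trans
    (x∈p⇒0<∣p∣ (∈-tabulate⁺ (incident (src e)) (incident-src e)))
    (degree≤Δ (src e))

-- Arithmetic in an ordered field.

module OrderedFieldProperties {c ℓ₁ ℓ₂} (F : ArchimedeanOrderedField c ℓ₁ ℓ₂) where
  open ArchimedeanOrderedField F
  open IsDecTotalOrder isDecTotalOrder public
    using (isPartialOrder; total; antisym; ≤-respˡ-≈; ≤-respʳ-≈)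
    renaming (refl to ≤-refl; reflexive to ≤-reflexive; trans to ≤-trans)
  open RingProperties ring using (-1*x≈-x)
  open AbelianGroupProperties +-abelianGroup using (⁻¹-involutive)
  open SemiringSum semiring using (sum-replicate-zero)

  poset : Poset c ℓ₁ ℓ₂
  poset = record { isPartialOrder = isPartialOrder }

  open PosetReasoning poset

  +-monoˡ-≤ : ∀ z {x y} → x ≤ y → x + z ≤ y + z
  +-monoˡ-≤ z {x} {y} x≤y = begin
    x + z  ≈⟨ +-comm x z ⟩
    z + x  ≤⟨ +-monoʳ-≤ z x≤y ⟩
    z + y  ≈⟨ +-comm z y ⟩
    y + z  ∎

  +-mono-≤ : ∀ {x y u v} → x ≤ y → u ≤ v → x + u ≤ y + v
  +-mono-≤ {y = y} {u} x≤y u≤v = ≤-trans (+-monoˡ-≤ u x≤y) (+-monoʳ-≤ y u≤v)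

  +-cancelʳ-≤ : ∀ z {x y} → x + z ≤ y + z → x ≤ y
  +-cancelʳ-≤ z {x} {y} le = begin
    x              ≈⟨ lemma x ⟨
    (x + z) - z    ≤⟨ +-monoˡ-≤ (- z) le ⟩
    (y + z) - z    ≈⟨ lemma y ⟩
    y              ∎
    where
    lemma : ∀ w → (w + z) - z ≈ w
    lemma w = trans (+-assoc w z (- z)) (trans (+-congˡ (-‿inverseʳ z)) (+-identityʳ w))

  x≤x+y : ∀ {x y} → 0# ≤ y → x ≤ x + y
  x≤x+y {x} {y} 0≤y = begin
    x       ≈⟨ +-identityʳ x ⟨
    x + 0#  ≤⟨ +-monoʳ-≤ x 0≤y ⟩
    x + y   ∎

  x≤y+x : ∀ {x y} → 0# ≤ y → x ≤ y + x
  x≤y+x {x} {y} 0≤y = ≤-respʳ-≈ (+-comm x y) (x≤x+y 0≤y)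

  x-y+y≈x : ∀ x y → (x - y) + y ≈ x
  x-y+y≈x x y = trans (+-assoc x (- y) y) (trans (+-congˡ (-‿inverseˡ y)) (+-identityʳ x))

  -- The axioms only speak of products of nonnegative elements, so `z` is split as `(z - y) + y`,
  -- and `x * (z - y)` is such a product.
  *-monoˡ-≤-nonNeg : ∀ {x} → 0# ≤ x → ∀ {y z} → y ≤ z → x * y ≤ x * z
  *-monoˡ-≤-nonNeg {x} 0≤x {y} {z} y≤z = begin
    x * y                  ≤⟨ x≤y+x (*-nonNeg 0≤x 0≤z-y) ⟩
    x * (z - y) + x * y    ≈⟨ distribˡ x (z - y) y ⟨
    x * ((z - y) + y)      ≈⟨ *-congˡ (x-y+y≈x z y) ⟩
    x * z                  ∎
    where
    0≤z-y : 0# ≤ z - y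
    0≤z-y = ≤-respˡ-≈ (-‿inverseʳ y) (+-monoˡ-≤ (- y) y≤z)

  *-monoʳ-≤-nonNeg : ∀ {x} → 0# ≤ x → ∀ {y z} → y ≤ z → y * x ≤ z * x
  *-monoʳ-≤-nonNeg {x} 0≤x {y} {z} y≤z = begin
    y * x  ≈⟨ *-comm y x ⟩
    x * y  ≤⟨ *-monoˡ-≤-nonNeg 0≤x y≤z ⟩
    x * z  ≈⟨ *-comm x z ⟩
    z * x  ∎

  0≤1 : 0# ≤ 1#
  0≤1 with total 0# 1#
  ... | inj₁ 0≤1 = 0≤1
  -- If 1 ≤ 0, then -1 is nonnegative, and so is its square, which is 1.
  ... | inj₂ 1≤0 = ≤-respʳ-≈ (trans (-1*x≈-x (- 1#)) (⁻¹-involutive 1#)) (*-nonNeg 0≤-1 0≤-1)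
    where
    0≤-1 : 0# ≤ - 1#
    0≤-1 = begin
      0#        ≈⟨ -‿inverseʳ 1# ⟨
      1# - 1#   ≤⟨ +-monoˡ-≤ (- 1#) 1≤0 ⟩
      0# - 1#   ≈⟨ +-identityˡ (- 1#) ⟩
      - 1#      ∎

  1≰0 : ¬ (1# ≤ 0#)
  1≰0 1≤0 = 0#≉1# (antisym 0≤1 1≤0)

  0≤fromℕ : ∀ k → 0# ≤ fromℕ k
  0≤fromℕ zero    = ≤-refl
  0≤fromℕ (suc k) = ≤-trans 0≤1 (x≤x+y (0≤fromℕ k))

  fromℕ-mono-≤ : ∀ {j k} → j ℕ.≤ k → fromℕ j ≤ fromℕ k
  fromℕ-mono-≤ {k = k} z≤n = 0≤fromℕ k
  fromℕ-mono-≤ (s≤s j≤k)   = +-monoʳ-≤ 1# (fromℕ-mono-≤ j≤k)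

  fromℕ-inverseʳ : ∀ {k} → 0 ℕ.< k → fromℕ k * fromℕ k ⁻¹ ≈ 1#
  fromℕ-inverseʳ {suc k} _ = *-inverseʳ _ λ eq →
    1≰0 (≤-respʳ-≈ eq (x≤x+y (0≤fromℕ k)))

  -- The order axioms do not mention inverses, so the sign comes from totality: a nonpositive
  -- inverse, multiplied by `fromℕ k`, would give 1 ≤ 0.
  0≤fromℕ⁻¹ : ∀ {k} → 0 ℕ.< k → 0# ≤ fromℕ k ⁻¹
  0≤fromℕ⁻¹ {k} 0<k with total 0# (fromℕ k ⁻¹)
  ... | inj₁ 0≤k⁻¹ = 0≤k⁻¹
  ... | inj₂ k⁻¹≤0 = contradiction 1≤0 1≰0
    where
    1≤0 : 1# ≤ 0#
    1≤0 = begin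
      1#                    ≈⟨ fromℕ-inverseʳ 0<k ⟨
      fromℕ k * fromℕ k ⁻¹  ≤⟨ *-monoˡ-≤-nonNeg (0≤fromℕ k) k⁻¹≤0 ⟩
      fromℕ k * 0#          ≈⟨ zeroʳ (fromℕ k) ⟩
      0#                    ∎

  fromℕ*fromℕ⁻¹≤1 : ∀ {j k} → 0 ℕ.< k → j ℕ.≤ k → fromℕ j * fromℕ k ⁻¹ ≤ 1#
  fromℕ*fromℕ⁻¹≤1 0<k j≤k = ≤-respʳ-≈ (fromℕ-inverseʳ 0<k)
    (*-monoʳ-≤-nonNeg (0≤fromℕ⁻¹ 0<k) (fromℕ-mono-≤ j≤k))

  -- Finite sums with indicator weights.

  when : Bool → Carrier → Carrier
  when b x = if b then x else 0#

  when-mono-≤ : ∀ b {x y} → (b ≡ true → x ≤ y) → when b x ≤ when b y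
  when-mono-≤ true  x≤y = x≤y ≡.refl
  when-mono-≤ false x≤y = ≤-refl

  when-nonNeg : ∀ b {x} → 0# ≤ x → 0# ≤ when b x
  when-nonNeg true  0≤x = 0≤x
  when-nonNeg false 0≤x = ≤-refl

  when-≤ : ∀ b {x} → 0# ≤ x → when b x ≤ x
  when-≤ true  0≤x = ≤-refl
  when-≤ false 0≤x = 0≤x

  -- An inequality, since the right side counts `x` twice when both disjuncts hold. With the
  -- disjunction in `incident`, it bounds an edge's contribution by its two ends.
  when-∨-≤ : ∀ a b {x} → 0# ≤ x → when (a ∨ b) x ≤ when a x + when b x
  when-∨-≤ true  b 0≤x = x≤x+y (when-nonNeg b 0≤x)
  when-∨-≤ false b 0≤x = x≤y+x ≤-refl

  *-when : ∀ b a x → a * when b x ≈ when b (a * x)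
  *-when true  a x = refl
  *-when false a x = zeroʳ a

  sum-mono-≤ : ∀ {n} {f g : Fin n → Carrier} → (∀ i → f i ≤ g i) → sum f ≤ sum g
  sum-mono-≤ {zero}  f≤g = ≤-refl
  sum-mono-≤ {suc n} f≤g = +-mono-≤ (f≤g Fin.zero) (sum-mono-≤ (f≤g ∘ Fin.suc))

  sum-nonNeg : ∀ {n} {f : Fin n → Carrier} → (∀ i → 0# ≤ f i) → 0# ≤ sum f
  sum-nonNeg {zero}  0≤f = ≤-refl
  sum-nonNeg {suc n} 0≤f = ≤-trans (0≤f Fin.zero) (x≤x+y (sum-nonNeg (0≤f ∘ Fin.suc)))

  term≤sum : ∀ {n} {f : Fin n → Carrier} → (∀ i → 0# ≤ f i) → ∀ i → f i ≤ sum f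
  term≤sum 0≤f Fin.zero    = x≤x+y (sum-nonNeg (0≤f ∘ Fin.suc))
  term≤sum 0≤f (Fin.suc i) = ≤-trans (term≤sum (0≤f ∘ Fin.suc) i) (x≤y+x (0≤f Fin.zero))

  when-sum : ∀ {n} b (f : Fin n → Carrier) → when b (sum f) ≈ sum (λ i → when b (f i))
  when-sum     true  f = refl
  when-sum {n} false f = sym (sum-replicate-zero n)

  sum-≟ : ∀ {n} (i : Fin n) x → sum (λ j → when (does (j ≟ i)) x) ≈ x
  sum-≟ {suc n} Fin.zero    x = trans (+-congˡ (sum-replicate-zero n)) (+-identityʳ x)
  sum-≟         (Fin.suc i) x = trans (+-identityˡ _) (sum-≟ i x)

  -- Converts between cardinalities and field sums, both for vertex sets and for the set of edges at
  -- a vertex.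
  sum-subset : ∀ {n} (p : Subset n) x → sum (λ i → when (lookup p i) x) ≈ fromℕ ∣ p ∣ * x
  sum-subset []          x = sym (zeroˡ x)
  sum-subset (true  ∷ p) x = begin-equality
    x + sum (λ i → when (lookup p i) x)  ≈⟨ +-cong (sym (*-identityˡ x)) (sum-subset p x) ⟩
    1# * x + fromℕ ∣ p ∣ * x             ≈⟨ distribʳ x 1# (fromℕ ∣ p ∣) ⟨
    (1# + fromℕ ∣ p ∣) * x               ∎
  sum-subset (false ∷ p) x = trans (+-identityˡ _) (sum-subset p x)

-- Loads, double counting, and the behaviour of the algorithm.

module VanillaProperties {c ℓ₁ ℓ₂} (F : ArchimedeanOrderedField c ℓ₁ ℓ₂) (G : Graph)
  (ε : ArchimedeanOrderedField.Carrier F) where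

  open ArchimedeanOrderedField F
  open OrderedFieldProperties F
  open Graph G
  open GraphProperties G
  open Vanilla F G ε
  open SemiringSum semiring using (sum-cong-≋; ∑-distrib-+; ∑-comm; *-distribˡ-sum)
  open PosetReasoning poset

  private
    variable
      x y : Fin m → Carrier
      S   : Subset n

  load-mono-≤ : ∀ v → (∀ e → incident v e ≡ true → x e ≤ y e) → load x v ≤ load y v
  load-mono-≤ v x≤y = sum-mono-≤ λ e → when-mono-≤ (incident v e) (x≤y e)

  load-* : ∀ a v → load (λ e → a * x e) v ≈ a * load x v
  load-* {x} a v = sym (trans
    (*-distribˡ-sum a (λ e → when (incident v e) (x e)))
    (sum-cong-≋ λ e → *-when (incident v e) a (x e)))

  value≤load : (∀ e → 0# ≤ x e) → ∀ e → x e ≤ load x (src e)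
  value≤load {x} 0≤x e = begin
    x e                               ≡⟨ ≡.cong (λ b → when b (x e)) (incident-src e) ⟨
    when (incident (src e) e) (x e)   ≤⟨ term≤sum (λ f → when-nonNeg (incident (src e) f) (0≤x f)) e ⟩
    load x (src e)                    ∎

  sum-load : ∀ S x → sum (λ v → when (lookup S v) (load x v)) ≈
             sum (λ e → sum (λ v → when (lookup S v) (when (incident v e) (x e))))
  sum-load S x = trans
    (sum-cong-≋ λ v → when-sum (lookup S v) (λ e → when (incident v e) (x e)))
    (∑-comm λ v e → when (lookup S v) (when (incident v e) (x e)))

  -- Weak duality of fractional matchings and vertex covers. In the double sum over vertices of `S`
  -- and their edges, each edge occurs at least once because `S` is a cover, while each vertex
  -- contributes at most 1.
  sum≤∣cover∣ : (∀ e → 0# ≤ x e) → (∀ v → load x v ≤ 1#) → IsVertexCover S → sum x ≤ fromℕ ∣ S ∣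
  sum≤∣cover∣ {x} {S} 0≤x load≤1 cover = begin
    sum x                                      ≤⟨ sum-mono-≤ (λ e → [ at-end e (incident-src e) , at-end e (incident-tgt e) ]′ (cover e)) ⟩
    sum (λ e → sum (term e))                   ≈⟨ sum-load S x ⟨
    sum (λ v → when (lookup S v) (load x v))   ≤⟨ sum-mono-≤ (λ v → when-mono-≤ (lookup S v) (λ _ → load≤1 v)) ⟩
    sum (λ v → when (lookup S v) 1#)           ≈⟨ sum-subset S 1# ⟩
    fromℕ ∣ S ∣ * 1#                           ≈⟨ *-identityʳ _ ⟩
    fromℕ ∣ S ∣                                ∎
    where
    term : Fin m → Fin n → Carrier
    term e v = when (lookup S v) (when (incident v e) (x e))

    0≤term : ∀ e v → 0# ≤ term e v
    0≤term e v = when-nonNeg (lookup S v) (when-nonNeg (incident v e) (0≤x e))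

    at-end : ∀ e {v} → incident v e ≡ true → v ∈ S → x e ≤ sum (term e)
    at-end e {v} inc v∈S = begin
      x e            ≡⟨ ≡.cong₂ (λ a b → when a (when b (x e))) ([]=⇒lookup v∈S) inc ⟨
      term e v       ≤⟨ term≤sum (0≤term e) v ⟩
      sum (term e)   ∎

  ∣S∣*a≤2sum : ∀ {a} → (∀ e → 0# ≤ x e) → (∀ v → v ∈ S → a ≤ load x v) →
               fromℕ ∣ S ∣ * a ≤ sum x + sum x
  ∣S∣*a≤2sum {x} {S} {a} 0≤x a≤load = begin
    fromℕ ∣ S ∣ * a                                                       ≈⟨ sum-subset S a ⟨
    sum (λ v → when (lookup S v) a)                                       ≤⟨ sum-mono-≤ (λ v → when-mono-≤ (lookup S v) (a≤load v ∘ lookup⇒[]= v S)) ⟩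
    sum (λ v → when (lookup S v) (load x v))                              ≈⟨ sum-load S x ⟩
    sum (λ e → sum (λ v → when (lookup S v) (when (incident v e) (x e)))) ≤⟨ sum-mono-≤ two-ends ⟩
    sum (λ e → x e + x e)                                                 ≈⟨ ∑-distrib-+ x x ⟩
    sum x + sum x                                                         ∎
    where
    two-ends : ∀ e → sum (λ v → when (lookup S v) (when (incident v e) (x e))) ≤ x e + x e
    two-ends e = begin
      sum (λ v → when (lookup S v) (when (incident v e) (x e)))
        ≤⟨ sum-mono-≤ (λ v → when-≤ (lookup S v) (when-nonNeg (incident v e) (0≤x e))) ⟩
      sum (λ v → when (incident v e) (x e))
        ≤⟨ sum-mono-≤ (λ v → when-∨-≤ (does (v ≟ src e)) (does (v ≟ tgt e)) (0≤x e)) ⟩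
      sum (λ v → when (does (v ≟ src e)) (x e) + when (does (v ≟ tgt e)) (x e))
        ≈⟨ ∑-distrib-+ (λ v → when (does (v ≟ src e)) (x e)) (λ v → when (does (v ≟ tgt e)) (x e)) ⟩
      sum (λ v → when (does (v ≟ src e)) (x e)) + sum (λ v → when (does (v ≟ tgt e)) (x e))
        ≈⟨ +-cong (sum-≟ (src e) (x e)) (sum-≟ (tgt e) (x e)) ⟩
      x e + x e ∎

  -- One round and the invariant it preserves.

  module _ (s : State) where

    ∈-tight⁻ : ∀ {v} → v ∈ tight (value s) → 1# - ε ≤ load (value s) v
    ∈-tight⁻ {v} v∈ = does-true ((1# - ε) ≤? load (value s) v) (∈-tabulate⁻ _ v∈)

    ∉-tight⁻ : ∀ {v} → v ∉ tight (value s) → load (value s) v ≤ 1# - ε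
    ∉-tight⁻ {v} v∉ with total (load (value s) v) (1# - ε)
    ... | inj₁ le = le
    ... | inj₂ ge = contradiction
      (∈-tabulate⁺ _ (dec-true ((1# - ε) ≤? load (value s) v) ge)) v∉

    round-active⁻ : ∀ {e} → e ∈ active (round s) →
      e ∈ active s × src e ∉ frozen (round s) × tgt e ∉ frozen (round s)
    -- The last scrutinee equates the conjunction defining the new active set with `true`; once the
    -- three lookups are abstracted, it rules out all other combinations.
    round-active⁻ {e} e∈ with lookup (active s) e in eqA
                            | lookup (frozen (round s)) (src e) in eqS
                            | lookup (frozen (round s)) (tgt e) in eqT
                            | ∈-tabulate⁻ _ e∈
    ... | true | false | false | _ =
      lookup⇒[]= e _ eqA , false⇒∉ eqS , false⇒∉ eqT
      where
      false⇒∉ : ∀ {v} → lookup (frozen (round s)) v ≡ false → v ∉ frozen (round s)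
      false⇒∉ eq v∈ with () ← ≡.trans (≡.sym eq) ([]=⇒lookup v∈)

    round-active⁺ : ∀ {e} → e ∈ active s → src e ∉ frozen (round s) → tgt e ∉ frozen (round s) →
      e ∈ active (round s)
    round-active⁺ {e} e∈ src∉ tgt∉ = ∈-tabulate⁺ _
      (≡.cong₂ _∧_ ([]=⇒lookup e∈)
        (≡.cong₂ (λ a b → not a ∧ not b) (∉⇒lookup≡false src∉) (∉⇒lookup≡false tgt∉)))

    round-value-active : ∀ {e} → e ∈ active (round s) → value (round s) e ≡ (1# + ε) * value s e
    round-value-active {e} e∈ =
      ≡.cong (λ b → if b then (1# + ε) * value s e else value s e) ([]=⇒lookup e∈)

    round-value-inactive : ∀ {e} → e ∉ active (round s) → value (round s) e ≡ value s e
    round-value-inactive {e} e∉ =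
      ≡.cong (λ b → if b then (1# + ε) * value s e else value s e) (∉⇒lookup≡false e∉)

    -- Freezing takes effect before the update: even a vertex that becomes frozen in this very round
    -- deactivates its edges before they could grow.
    frozen⇒value-unchanged : ∀ {v} → v ∈ frozen (round s) → ∀ e → incident v e ≡ true →
      value (round s) e ≡ value s e
    frozen⇒value-unchanged {v} v∈ e inc = round-value-inactive λ e∈ →
      let _ , src∉ , tgt∉ = round-active⁻ e∈
      in [ (λ { ≡.refl → src∉ v∈ }) , (λ { ≡.refl → tgt∉ v∈ }) ]′ (incident-ends v e inc)

  -- The first two clauses make the values a fractional matching, the third bounds the number of
  -- frozen vertices, and the last turns into the vertex cover property once no edge is active.
  record Invariant (s : State) : Set (c Level.⊔ ℓ₁ Level.⊔ ℓ₂) where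
    field
      0≤value  : ∀ e → 0# ≤ value s e
      load≤1   : ∀ v → load (value s) v ≤ 1#
      1-ε≤load : ∀ v → v ∈ frozen s → 1# - ε ≤ load (value s) v
      covered  : ∀ e → e ∉ active s → src e ∈ frozen s ⊎ tgt e ∈ frozen s

  open Invariant

  initial-invariant : Invariant initial
  initial-invariant .0≤value e      = 0≤fromℕ⁻¹ (edge⇒0<Δ e)
  initial-invariant .1-ε≤load v v∈  = contradiction v∈ ∉⊥
  initial-invariant .covered e e∉   = contradiction ∈⊤ e∉
  initial-invariant .load≤1 v       = begin
    load (value initial) v
      ≈⟨ sum-cong-≋ (λ e → reflexive (≡.cong (λ b → when b (fromℕ Δ ⁻¹)) (lookup∘tabulate (incident v) e))) ⟨
    sum (λ e → when (lookup (tabulate (incident v)) e) (fromℕ Δ ⁻¹))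
      ≈⟨ sum-subset (tabulate (incident v)) (fromℕ Δ ⁻¹) ⟩
    fromℕ (degree v) * fromℕ Δ ⁻¹
      ≤⟨ bound (degree≤Δ v) ⟩
    1# ∎
    where
    -- Degree 0 is treated apart because `k` may then be 0, where the inverse is unspecified; the
    -- product vanishes all the same. A positive degree forces `k` to be positive.
    bound : ∀ {d k} → d ℕ.≤ k → fromℕ d * fromℕ k ⁻¹ ≤ 1#
    bound z≤n       = ≤-trans (≤-reflexive (zeroˡ _)) 0≤1
    bound (s≤s d≤k) = fromℕ*fromℕ⁻¹≤1 (s≤s z≤n) (s≤s d≤k)

  module _ (0≤ε : 0# ≤ ε) where

    0≤1+ε : 0# ≤ 1# + ε
    0≤1+ε = ≤-trans 0≤1 (x≤x+y 0≤ε)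

    a≤[1+ε]a : ∀ {a} → 0# ≤ a → a ≤ (1# + ε) * a
    a≤[1+ε]a {a} 0≤a = begin
      a             ≈⟨ *-identityˡ a ⟨
      1# * a        ≤⟨ *-monoʳ-≤-nonNeg 0≤a (x≤x+y 0≤ε) ⟩
      (1# + ε) * a  ∎

    [1+ε][1-ε]≤1 : (1# + ε) * (1# - ε) ≤ 1#
    [1+ε][1-ε]≤1 = begin
      (1# + ε) * (1# - ε)             ≈⟨ distribʳ (1# - ε) 1# ε ⟩
      1# * (1# - ε) + ε * (1# - ε)    ≤⟨ +-mono-≤ (≤-reflexive (*-identityˡ _)) (*-monoˡ-≤-nonNeg 0≤ε 1-ε≤1) ⟩
      (1# - ε) + ε * 1#               ≈⟨ +-congˡ (*-identityʳ ε) ⟩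
      (1# - ε) + ε                    ≈⟨ x-y+y≈x 1# ε ⟩
      1#                              ∎
      where
      1-ε≤1 : 1# - ε ≤ 1#
      1-ε≤1 = ≤-respʳ-≈ (x-y+y≈x 1# ε) (x≤x+y 0≤ε)

    round-invariant : ∀ {s} → Invariant s → Invariant (round s)
    round-invariant {s} inv = record
      { 0≤value  = λ e → ≤-trans (0≤value inv e) (value≤ e)
      ; load≤1   = load≤1′
      ; 1-ε≤load = λ v v∈ → begin
          -- The vertex was either frozen earlier or is tight now; in both cases the bound holds
          -- before the update, and values never decrease.
          1# - ε                   ≤⟨ [ 1-ε≤load inv v , ∈-tight⁻ s ]′ (x∈p∪q⁻ (frozen s) _ v∈) ⟩
          load (value s) v         ≤⟨ load-mono-≤ v (λ e _ → value≤ e) ⟩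
          load (value (round s)) v ∎
      ; covered  = covered′
      }
      where
      value≤ : ∀ e → value s e ≤ value (round s) e
      value≤ e with e ∈? active (round s)
      ... | yes e∈ = ≤-respʳ-≈ (reflexive (≡.sym (round-value-active s e∈))) (a≤[1+ε]a (0≤value inv e))
      ... | no  e∉ = ≤-reflexive (reflexive (≡.sym (round-value-inactive s e∉)))

      value≤[1+ε]value : ∀ e → value (round s) e ≤ (1# + ε) * value s e
      value≤[1+ε]value e with e ∈? active (round s)
      ... | yes e∈ = ≤-reflexive (reflexive (round-value-active s e∈))
      ... | no  e∉ = ≤-trans (≤-reflexive (reflexive (round-value-inactive s e∉))) (a≤[1+ε]a (0≤value inv e))

      load≤1′ : ∀ v → load (value (round s)) v ≤ 1#
      load≤1′ v with v ∈? frozen (round s)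
      ... | yes v∈ = ≤-trans
        (load-mono-≤ v λ e inc → ≤-reflexive (reflexive (frozen⇒value-unchanged s v∈ e inc)))
        (load≤1 inv v)
      ... | no  v∉ = begin
        load (value (round s)) v               ≤⟨ load-mono-≤ v (λ e _ → value≤[1+ε]value e) ⟩
        load (λ e → (1# + ε) * value s e) v    ≈⟨ load-* (1# + ε) v ⟩
        -- A vertex still unfrozen after the round was not tight for the old values.
        (1# + ε) * load (value s) v            ≤⟨ *-monoˡ-≤-nonNeg 0≤1+ε (∉-tight⁻ s (v∉ ∘ x∈p∪q⁺ ∘ inj₂)) ⟩
        (1# + ε) * (1# - ε)                    ≤⟨ [1+ε][1-ε]≤1 ⟩
        1#                                     ∎

      covered′ : ∀ e → e ∉ active (round s) → src e ∈ frozen (round s) ⊎ tgt e ∈ frozen (round s)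
      covered′ e e∉ with src e ∈? frozen (round s) | tgt e ∈? frozen (round s)
      ... | yes src∈ | _        = inj₁ src∈
      ... | no  _    | yes tgt∈ = inj₂ tgt∈
      ... | no  src∉ | no  tgt∉ =
        -- With both ends unfrozen, an active edge would have stayed active. So the edge was
        -- inactive before, and the old clause applies because frozen vertices stay frozen.
        Sum.map (x∈p∪q⁺ ∘ inj₁) (x∈p∪q⁺ ∘ inj₁)
          (covered inv e λ e∈ → e∉ (round-active⁺ s e∈ src∉ tgt∉))

    ⇓-invariant : ∀ {s t} → s ⇓ t → Invariant s → Invariant t × Empty (active t)
    ⇓-invariant (halt empty)  inv = inv , empty
    ⇓-invariant (next _ run)  inv = ⇓-invariant run (round-invariant inv)

    -- Termination.

    Grown : ℕ → State → Set ℓ₂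
    Grown k s = ∀ e → e ∈ active s → 1# + fromℕ k * ε ≤ fromℕ Δ * value s e

    initial-grown : Grown 0 initial
    initial-grown e _ = begin
      1# + 0# * ε           ≈⟨ trans (+-congˡ (zeroˡ ε)) (+-identityʳ 1#) ⟩
      1#                    ≈⟨ fromℕ-inverseʳ (edge⇒0<Δ e) ⟨
      fromℕ Δ * fromℕ Δ ⁻¹  ∎

    -- The right side exceeds the left by `fromℕ k * ε * ε`, which is nonnegative.
    bernoulli-step : ∀ k → 1# + fromℕ (suc k) * ε ≤ (1# + ε) * (1# + fromℕ k * ε)
    bernoulli-step k = begin
      1# + (1# + fromℕ k) * ε          ≈⟨ +-congˡ (trans (distribʳ ε 1# (fromℕ k)) (+-comm _ _)) ⟩
      1# + (fromℕ k * ε + 1# * ε)      ≈⟨ +-assoc 1# _ _ ⟨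
      b + 1# * ε                       ≈⟨ +-cong (sym (*-identityˡ b)) (*-comm 1# ε) ⟩
      1# * b + ε * 1#                  ≤⟨ +-monoʳ-≤ (1# * b) (*-monoˡ-≤-nonNeg 0≤ε (x≤x+y (*-nonNeg (0≤fromℕ k) 0≤ε))) ⟩
      1# * b + ε * b                   ≈⟨ distribʳ b 1# ε ⟨
      (1# + ε) * b                     ∎
      where
      b : Carrier
      b = 1# + fromℕ k * ε

    -- An edge active after the round was active before it, so the old bound holds for it and its
    -- value has just been multiplied by `1# + ε`.
    round-grown : ∀ {k s} → Grown k s → Grown (suc k) (round s)
    round-grown {k} {s} grown e e∈ = begin
      1# + fromℕ (suc k) * ε                ≤⟨ bernoulli-step k ⟩
      (1# + ε) * (1# + fromℕ k * ε)         ≤⟨ *-monoˡ-≤-nonNeg 0≤1+ε (grown e (proj₁ (round-active⁻ s e∈))) ⟩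
      (1# + ε) * (fromℕ Δ * value s e)      ≈⟨ *-assoc (1# + ε) (fromℕ Δ) (value s e) ⟨
      (1# + ε) * fromℕ Δ * value s e        ≈⟨ *-congʳ (*-comm (1# + ε) (fromℕ Δ)) ⟩
      fromℕ Δ * (1# + ε) * value s e        ≈⟨ *-assoc (fromℕ Δ) (1# + ε) (value s e) ⟩
      fromℕ Δ * ((1# + ε) * value s e)      ≡⟨ ≡.cong (fromℕ Δ *_) (round-value-active s e∈) ⟨
      fromℕ Δ * value (round s) e           ∎

    -- The value of an edge is at most the load of its source, hence at most 1. An active edge would
    -- thus give 1 + kε ≤ Δ ≤ kε.
    grown⇒empty : ∀ {k s} → Invariant s → Grown k s → fromℕ Δ ≤ fromℕ k * ε → Empty (active s)
    grown⇒empty {k} {s} inv grown Δ≤kε (e , e∈) = 1≰0 (+-cancelʳ-≤ (fromℕ k * ε) (begin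
      1# + fromℕ k * ε      ≤⟨ grown e e∈ ⟩
      fromℕ Δ * value s e   ≤⟨ *-monoˡ-≤-nonNeg (0≤fromℕ Δ) (≤-trans (value≤load (0≤value inv) e) (load≤1 inv (src e))) ⟩
      fromℕ Δ * 1#          ≈⟨ *-identityʳ (fromℕ Δ) ⟩
      fromℕ Δ               ≤⟨ Δ≤kε ⟩
      fromℕ k * ε           ≈⟨ +-identityˡ (fromℕ k * ε) ⟨
      0# + fromℕ k * ε      ∎))

    -- Here `k` counts the rounds already done and `fuel` those still allowed. Their sum stays
    -- fixed, and when `fuel` runs out the growth bound leaves no active edge.
    terminates : ∀ fuel {k s} → Invariant s → Grown k s → fromℕ Δ ≤ fromℕ (fuel ℕ.+ k) * ε →
                 ∃ λ t → s ⇓ t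
    terminates zero {k} {s} inv grown Δ≤ = s , halt (grown⇒empty {k} inv grown Δ≤)
    terminates (suc fuel) {k} {s} inv grown Δ≤ with nonempty? (active s)
    ... | no  empty    = s , halt empty
    ... | yes nonempty =
      let t , run = terminates fuel {suc k} (round-invariant inv) (round-grown {k} {s} grown)
                      (≡.subst (λ j → fromℕ Δ ≤ fromℕ j * ε) (≡.sym (ℕ.+-suc fuel k)) Δ≤)
      in t , next nonempty run

    initial-terminates : ¬ (ε ≈ 0#) → ∃ λ t → initial ⇓ t
    initial-terminates ε≉0 =
      -- Any N ≥ Δ/ε bounds the number of rounds, since then Nε ≥ Δ.
      let N , Δ/ε≤N = archimedean (fromℕ Δ * ε ⁻¹)
      in terminates N {0} initial-invariant initial-grown (begin
        fromℕ Δ                 ≈⟨ *-identityʳ (fromℕ Δ) ⟨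
        fromℕ Δ * 1#            ≈⟨ *-congˡ (trans (*-comm (ε ⁻¹) ε) (*-inverseʳ ε ε≉0)) ⟨
        fromℕ Δ * (ε ⁻¹ * ε)    ≈⟨ *-assoc (fromℕ Δ) (ε ⁻¹) ε ⟨
        fromℕ Δ * ε ⁻¹ * ε      ≤⟨ *-monoʳ-≤-nonNeg 0≤ε Δ/ε≤N ⟩
        fromℕ N * ε             ≡⟨ ≡.cong (λ j → fromℕ j * ε) (ℕ.+-identityʳ N) ⟨
        fromℕ (N ℕ.+ 0) * ε     ∎)

    -- The approximation ratio.

    1≤[1-ε][1+2ε] : ε + ε ≤ 1# → 1# ≤ (1# - ε) * (1# + (ε + ε))
    1≤[1-ε][1+2ε] 2ε≤1 = begin
      1#                          ≈⟨ δ+ε≈1 ⟨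
      -- The summand ε is rewritten as (δ + ε)ε; replacing the inner ε by δ, which is at least as
      -- large, makes δ a common factor.
      δ + ε                       ≈⟨ +-cong (sym (*-identityʳ δ)) (sym (trans (*-congʳ δ+ε≈1) (*-identityˡ ε))) ⟩
      δ * 1# + (δ + ε) * ε        ≤⟨ +-monoʳ-≤ (δ * 1#) (*-monoʳ-≤-nonNeg 0≤ε (+-monoʳ-≤ δ ε≤δ)) ⟩
      δ * 1# + (δ + δ) * ε        ≈⟨ +-congˡ (trans (distribʳ ε δ δ) (sym (distribˡ δ ε ε))) ⟩
      δ * 1# + δ * (ε + ε)        ≈⟨ distribˡ δ 1# (ε + ε) ⟨
      δ * (1# + (ε + ε))          ∎
      where
      δ : Carrier
      δ = 1# - ε

      δ+ε≈1 : δ + ε ≈ 1#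
      δ+ε≈1 = x-y+y≈x 1# ε

      ε≤δ : ε ≤ δ
      ε≤δ = +-cancelʳ-≤ ε (≤-respʳ-≈ (sym δ+ε≈1) 2ε≤1)

    -- The ratio arises as 2(1 + 2ε): the 2 comes from the two ends of an edge, and `b` compensates
    -- for the factor 1 - ε in the load of a frozen vertex.
    invariant⇒∣frozen∣≤ : ∀ {s} → ε + ε ≤ 1# → Invariant s → IsVertexCover S →
      fromℕ ∣ frozen s ∣ ≤ (fromℕ 2 + fromℕ 4 * ε) * fromℕ ∣ S ∣
    invariant⇒∣frozen∣≤ {S} {s} 2ε≤1 inv cover = begin
      k                           ≈⟨ *-identityʳ k ⟨
      k * 1#                      ≤⟨ *-monoˡ-≤-nonNeg (0≤fromℕ ∣ frozen s ∣) (1≤[1-ε][1+2ε] 2ε≤1) ⟩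
      k * ((1# - ε) * b)          ≈⟨ *-assoc k (1# - ε) b ⟨
      k * (1# - ε) * b            ≤⟨ *-monoʳ-≤-nonNeg 0≤b (∣S∣*a≤2sum (0≤value inv) (1-ε≤load inv)) ⟩
      (sum (value s) + sum (value s)) * b ≤⟨ *-monoʳ-≤-nonNeg 0≤b (+-mono-≤ Σ≤l Σ≤l) ⟩
      (l + l) * b                 ≈⟨ lemma ⟩
      (fromℕ 2 + fromℕ 4 * ε) * l ∎
      where
      k l b : Carrier
      k = fromℕ ∣ frozen s ∣
      l = fromℕ ∣ S ∣
      b = 1# + (ε + ε)

      0≤b : 0# ≤ b
      0≤b = ≤-trans 0≤1 (x≤x+y (≤-trans 0≤ε (x≤x+y 0≤ε)))

      Σ≤l : sum (value s) ≤ l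
      Σ≤l = sum≤∣cover∣ (0≤value inv) (load≤1 inv) cover

      lemma : (l + l) * b ≈ (fromℕ 2 + fromℕ 4 * ε) * l
      lemma = solve 2
        (λ u e → (u :+ u) :* (con 1 :+ (e :+ e)) := (numeral 2 :+ numeral 4 :* e) :* u)
        refl l ε
        where
        open import Algebra.Solver.Ring.NaturalCoefficients.Default commutativeSemiring

        -- `con k` evaluates to 1# + … + 1# without the trailing 0# of `fromℕ k`.
        numeral : ℕ → Polynomial 2
        numeral zero    = con 0
        numeral (suc k) = con 1 :+ numeral k

claim4p14 : ∀ {c ℓ₁ ℓ₂} (F : ArchimedeanOrderedField c ℓ₁ ℓ₂) (G : Graph) →
    let open ArchimedeanOrderedField F
        open Graph G
    in (ε : Carrier) → 0# < ε → ε ≤ fromℕ 1000 ⁻¹ →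
       let open Vanilla F G ε in
       (C* : Subset n) → IsMinimumVertexCover C* →
       (∃ λ C → FrozenSet C) ×
       (∀ C → FrozenSet C →
         IsVertexCover C ×
         fromℕ ∣ C ∣ ≤ (fromℕ 2 + fromℕ 4 * ε) * fromℕ ∣ C* ∣)
claim4p14 F G ε (0≤ε , 0≉ε) ε≤1/1000 C* (C*-cover , _) = exists , correct
  where
  open ArchimedeanOrderedField F
  open OrderedFieldProperties F
  open Graph G
  open Vanilla F G ε
  open VanillaProperties F G ε
  open PosetReasoning poset

  -- Comes from 2 ≤ 1000, and supplies ε ≤ 1 - ε in the estimate of the ratio.
  2ε≤1 : ε + ε ≤ 1#
  2ε≤1 = begin
    ε + ε                    ≈⟨ +-cong (sym (*-identityˡ ε)) (sym (*-identityˡ ε)) ⟩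
    1# * ε + 1# * ε          ≈⟨ distribʳ ε 1# 1# ⟨
    (1# + 1#) * ε            ≈⟨ *-congʳ (+-congˡ (+-identityʳ 1#)) ⟨
    fromℕ 2 * ε              ≤⟨ *-monoˡ-≤-nonNeg (0≤fromℕ 2) ε≤1/1000 ⟩
    fromℕ 2 * fromℕ 1000 ⁻¹  ≤⟨ fromℕ*fromℕ⁻¹≤1 {2} {1000} (s≤s z≤n) (s≤s (s≤s z≤n)) ⟩
    1#                       ∎

  -- `FrozenSet` presupposes a finished run, so without this termination result the claim about
  -- every such `C` might hold vacuously.
  exists : ∃ λ C → FrozenSet C
  exists =
    let t , run = initial-terminates 0≤ε (λ ε≈0 → 0≉ε (sym ε≈0))
    in frozen t , t , run , ≡.refl

  correct : ∀ C → FrozenSet C →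
    IsVertexCover C × fromℕ ∣ C ∣ ≤ (fromℕ 2 + fromℕ 4 * ε) * fromℕ ∣ C* ∣
  correct _ (t , run , ≡.refl) =
    let inv , empty = ⇓-invariant 0≤ε run initial-invariant
    -- At the end no edge is active, so `covered` applies to all edges.
    in (λ e → Invariant.covered inv e λ e∈ → empty (e , e∈)) ,
       invariant⇒∣frozen∣≤ 0≤ε 2ε≤1 inv C*-cover
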